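{- For each integer $k > 2$ there is a constant $C_k > 0$ such that for all positive integers $n$ and $r$, \[ s_{kn}(C_{n}^{r}) > \frac{kn}{4}\left[1+\frac{(k-1)^{k-1}}{k^{k}}-\frac{C_k}{n}\right]^{r}. \] (In the paper's notation: $s_{kn}(C_{n}^{r}) > \frac{kn}{4}\left[1+\frac{(k-1)^{k-1}}{k^{k}}-O(\frac{1}{n})\right]^{r}$.)
   Context: For a finite Abelian group $G$ and a positive integer $m$, $s_{m}(G)$ denotes the minimal integer $L$ such that every sequence of $L$ (not necessarily distinct) elements of $G$ contains a subsequence of exactly $m$ terms whose sum is $0$. $C_n$ denotes the cyclic group of order $n$, and $C_n^r$ is the direct product of $r$ copies of $C_n$. -}

module Defs where

open import Data.Nat using (ℕ; zero; suc; _+_; _*_; _∸_; _^_; _≤_; NonZero)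
open import Data.Nat.Properties using (m^n≢0)
open import Data.Nat.Divisibility using (_∣_)
open import Data.Bool using (true; false)
open import Data.Fin using (Fin; toℕ)
open import Data.Fin.Subset using (Subset; ∣_∣)
open import Data.Vec using (Vec; []; _∷_; lookup; map)
open import Data.Integer using (+_)
open import Data.Rational using (ℚ; _/_; 0ℚ; 1ℚ) renaming (_*_ to _*ℚ_)
open import Data.Product using (Σ; _×_)
open import Relation.Binary.PropositionalEquality using (_≡_)

-- Elements of C_n^r: r-tuples of residues mod n (Fin n = {0,…,n-1}).
Elem : ℕ → ℕ → Set
Elem n r = Vec (Fin n) r

Seq : ℕ → ℕ → ℕ → Set
Seq n r L = Vec (Elem n r) L

sumSel : ∀ {L} → Subset L → Vec ℕ L → ℕ
sumSel [] [] = 0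
sumSel (true ∷ p) (x ∷ xs) = x + sumSel p xs
sumSel (false ∷ p) (x ∷ xs) = sumSel p xs

SumsToZero : ∀ {n r L} → Seq n r L → Subset L → Set
SumsToZero {n} {r} s p = (j : Fin r) → n ∣ sumSel p (map (λ g → toℕ (lookup g j)) s)

HasZeroSumSubseq : ∀ {n r L} → ℕ → Seq n r L → Set
HasZeroSumSubseq {L = L} m s = Σ (Subset L) λ p → (∣ p ∣ ≡ m) × SumsToZero s p

ZSProp : ℕ → ℕ → ℕ → ℕ → Set
ZSProp n r m L = (s : Seq n r L) → HasZeroSumSubseq m s

IsSm : ℕ → ℕ → ℕ → ℕ → Set
IsSm n r m L = ZSProp n r m L × ((L' : ℕ) → ZSProp n r m L' → L ≤ L')

powℚ : ℚ → ℕ → ℚ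
powℚ q zero = 1ℚ
powℚ q (suc e) = q *ℚ powℚ q e

-- (k-1)^(k-1) / k^k as a rational (k = 0 case is irrelevant, set to 0).
kTerm : ℕ → ℚ
kTerm zero = 0ℚ
kTerm (suc j) = (+ (j ^ j) / (suc j ^ suc j)) {{m^n≢0 (suc j) (suc j)}}

{-# OPTIONS --safe #-}
module Submission where

-- Put a = (k-1)^(k-1), b = k^k, t = a/b and m = kn, and draw the coordinates of l
-- elements of C_n^r independently, 1 with probability t/(1+t) and 0 otherwise.
-- For m given terms, a coordinate sums to 0 mod n when the number i of ones is 0
-- or a multiple of n with i ≥ n.  Since C(m,i) t^i = ((k-1)t)^i C(m,i) (k-1)^(-i) and
-- (k-1)t = ((k-1)/k)^k ≤ 1, both events have probability at most (1+t)^(-m).  If every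
-- sequence of length l has a zero-sum subsequence of length m, the union bound gives
--   1 ≤ C(l,m) (2 (1+t)^(-m))^r,
-- and C(l,m) ≤ l^m / m!, m^m < 4^m m!, 2 (n-1)^m ≤ n^m turn this into
--   l > (m/4) ((1+t)(1-1/n))^r,
-- which is the claim for C = 1+t.  This C makes the base vanish at n = 1; a C above
-- 2+t would fail there, because the base would drop below -1.

open import Defs
open import Data.Bool using (true; false; if_then_else_)
open import Data.Fin using (Fin; zero; suc; toℕ)
open import Data.Fin.Subset using (Subset; ∣_∣)
open import Data.Integer using (+_)
import Data.Integer as ℤ
import Data.Integer.Properties as ℤₚ
open import Data.Nat using (ℕ; zero; suc; _+_; _*_; _∸_; _^_; _!; _<_; _≤_; s≤s; z≤n; s≤s⁻¹; NonZero; >-nonZero)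
open import Data.Nat.Divisibility using (_∣_; _∣?_; ∣⇒≤)
open import Data.Nat.Properties
open import Data.Integer.Tactic.RingSolver renaming (solve-∀ to ℤ-solve-∀) using ()
open import Algebra.Properties.CommutativeSemigroup *-commutativeSemigroup using (interchange; x∙yz≈y∙xz)
open import Data.Nat.Tactic.RingSolver using (solve-∀)
open import Data.Product using (Σ; _×_; _,_)
open import Data.Rational using (ℚ; _/_; 0ℚ; 1ℚ; toℚᵘ) renaming (-_ to -ℚ_; _*_ to _*ℚ_; _+_ to _+ℚ_; _-_ to _-ℚ_; _<_ to _<ℚ_)
import Data.Rational.Properties as ℚₚ
import Data.Rational.Unnormalised as ℚᵘ
import Data.Rational.Unnormalised.Properties as ℚᵘₚ
open import Data.Vec using (Vec; []; _∷_; lookup; map; tabulate)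
open import Data.Vec.Properties using (tabulate-∘; lookup∘tabulate; tabulate∘lookup; tabulate-cong)
open import Relation.Binary.PropositionalEquality using (_≡_; refl; sym; trans; cong; cong₂; subst; subst₂; module ≡-Reasoning)
open import Relation.Nullary using (yes; no; does; contradiction)

-- Powers and factorials

^-distribʳ-* : ∀ m n o → (m * n) ^ o ≡ m ^ o * n ^ o
^-distribʳ-* m n zero    = refl
^-distribʳ-* m n (suc o) rewrite ^-distribʳ-* m n o = interchange m n (m ^ o) (n ^ o)

^-cancelˡ-< : ∀ o {m n} → m ^ o < n ^ o → m < n
^-cancelˡ-< o m^o<n^o = ≰⇒> λ n≤m → <⇒≱ m^o<n^o (^-monoˡ-≤ o n≤m)

-- The left side consists of the first two terms of the binomial expansion of the right side.
bernoulli : ∀ m o → m ^ suc o + suc o * m ^ o ≤ suc m ^ suc o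
bernoulli m zero    = ≤-reflexive (base m)
  where
  base : ∀ m → m * 1 + 1 * 1 ≡ suc m * 1
  base = solve-∀
bernoulli m (suc o) = begin
  m ^ suc (suc o) + suc (suc o) * m ^ suc o
    ≤⟨ m≤m+n _ (suc o * m ^ o) ⟩
  m ^ suc (suc o) + suc (suc o) * m ^ suc o + suc o * m ^ o
    ≡⟨ factor m o (m ^ o) ⟩
  suc m * (m ^ suc o + suc o * m ^ o)
    ≤⟨ *-monoʳ-≤ (suc m) (bernoulli m o) ⟩
  suc m ^ suc (suc o) ∎
  where
  open ≤-Reasoning
  factor : ∀ m o p → m * (m * p) + suc (suc o) * (m * p) + suc o * p ≡ suc m * (m * p + suc o * p)
  factor = solve-∀

-- The difference of the two powers is a sum of `suc o` products of `o` factors, each factor at most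
-- `suc m`. This drives the induction for the exponential bound below.
[1+m]^[1+o]≤m^[1+o]+[1+o]*[1+m]^o : ∀ m o → suc m ^ suc o ≤ m ^ suc o + suc o * suc m ^ o
[1+m]^[1+o]≤m^[1+o]+[1+o]*[1+m]^o m zero    = ≤-reflexive (base m)
  where
  base : ∀ m → suc m * 1 ≡ m * 1 + 1 * 1
  base = solve-∀
[1+m]^[1+o]≤m^[1+o]+[1+o]*[1+m]^o m (suc o) = begin
  p + m * p
    ≤⟨ +-monoʳ-≤ p (*-monoʳ-≤ m ([1+m]^[1+o]≤m^[1+o]+[1+o]*[1+m]^o m o)) ⟩
  p + m * (m ^ suc o + suc o * suc m ^ o)
    ≤⟨ m≤m+n _ (suc o * suc m ^ o) ⟩
  p + m * (m ^ suc o + suc o * suc m ^ o) + suc o * suc m ^ o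
    ≡⟨ regroup m o (m ^ suc o) (suc m ^ o) ⟩
  m * m ^ suc o + suc (suc o) * p ∎
  where
  open ≤-Reasoning
  p = suc m ^ suc o
  regroup : ∀ m o x y → suc m * y + m * (x + suc o * y) + suc o * y ≡ m * x + suc (suc o) * (suc m * y)
  regroup = solve-∀

-- In `bernoulli` the second term is at least the first once `m ≤ n`. This later absorbs the factor
-- 2 that the two events cost in each coordinate.
2*m^n≤[1+m]^n : ∀ m n .{{_ : NonZero n}} → m ≤ n → 2 * m ^ n ≤ suc m ^ n
2*m^n≤[1+m]^n m (suc o) m≤n = begin
  2 * m ^ suc o                ≡⟨ cong (λ x → m ^ suc o + x) (+-identityʳ _) ⟩
  m ^ suc o + m * m ^ o        ≤⟨ +-monoʳ-≤ (m ^ suc o) (*-monoˡ-≤ (m ^ o) m≤n) ⟩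
  m ^ suc o + suc o * m ^ o    ≤⟨ bernoulli m o ⟩
  suc m ^ suc o                ∎
  where open ≤-Reasoning

-- Each summand on the left is exactly half of the right side.
m!*2^[l+m]-recurrence : ∀ l o →
  suc o ! * 2 ^ (l + suc o) + suc o * (o ! * 2 ^ (suc l + o)) ≡ suc o ! * 2 ^ (suc l + suc o)
m!*2^[l+m]-recurrence l o rewrite +-suc l o = identity o (o !) (2 ^ suc (l + o))
  where
  identity : ∀ o x y → suc o * x * y + suc o * (x * y) ≡ suc o * x * (2 * y)
  identity = solve-∀

-- A two-parameter form of l ^ m / m ! ≤ exp l that admits a direct induction.
l^m≤m!*2^[l+m] : ∀ l m → l ^ m ≤ m ! * 2 ^ (l + m)
l^m≤m!*2^[l+m] l       zero    = ≤-trans (m^n>0 2 (l + 0)) (≤-reflexive (sym (+-identityʳ _)))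
l^m≤m!*2^[l+m] zero    (suc o) = z≤n
l^m≤m!*2^[l+m] (suc l) (suc o) = begin
  suc l ^ suc o
    ≤⟨ [1+m]^[1+o]≤m^[1+o]+[1+o]*[1+m]^o l o ⟩
  l ^ suc o + suc o * suc l ^ o
    ≤⟨ +-mono-≤ (l^m≤m!*2^[l+m] l (suc o)) (*-monoʳ-≤ (suc o) (l^m≤m!*2^[l+m] (suc l) o)) ⟩
  suc o ! * 2 ^ (l + suc o) + suc o * (o ! * 2 ^ (suc l + o))
    ≡⟨ m!*2^[l+m]-recurrence l o ⟩
  suc o ! * 2 ^ (suc l + suc o) ∎
  where open ≤-Reasoning

-- Strictness starts at `l = 0`, where the left side is 0, and passes through the first summand. The
-- exponent in the second summand may be 0, so the weak form serves there.
l^m<m!*2^[l+m] : ∀ l m .{{_ : NonZero m}} → l ^ m < m ! * 2 ^ (l + m)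
l^m<m!*2^[l+m] zero    (suc o) = *-mono-< (1≤n! (suc o)) (m^n>0 2 (suc o))
l^m<m!*2^[l+m] (suc l) (suc o) = begin-strict
  suc l ^ suc o
    ≤⟨ [1+m]^[1+o]≤m^[1+o]+[1+o]*[1+m]^o l o ⟩
  l ^ suc o + suc o * suc l ^ o
    <⟨ +-mono-<-≤ (l^m<m!*2^[l+m] l (suc o)) (*-monoʳ-≤ (suc o) (l^m≤m!*2^[l+m] (suc l) o)) ⟩
  suc o ! * 2 ^ (l + suc o) + suc o * (o ! * 2 ^ (suc l + o))
    ≡⟨ m!*2^[l+m]-recurrence l o ⟩
  suc o ! * 2 ^ (suc l + suc o) ∎
  where open ≤-Reasoning

-- A crude form of Stirling's bound, with 4 in place of e; it is the source of the 4 in the theorem.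
m^m<4^m*m! : ∀ m .{{_ : NonZero m}} → m ^ m < 4 ^ m * m !
m^m<4^m*m! m = begin-strict
  m ^ m               <⟨ l^m<m!*2^[l+m] m m ⟩
  m ! * 2 ^ (m + m)   ≡⟨ cong (m ! *_) (^-distribˡ-+-* 2 m m) ⟩
  m ! * (2 ^ m * 2 ^ m) ≡⟨ cong (m ! *_) (^-distribʳ-* 2 2 m) ⟨
  m ! * 4 ^ m         ≡⟨ *-comm (m !) _ ⟩
  4 ^ m * m !         ∎
  where open ≤-Reasoning

-- Positive linear functionals on ℕ-valued functions

-- Expectations, scaled so as to stay in ℕ, enter only through these laws, so no sample space has to
-- be enumerated.
record Positive {A : Set} (I : (A → ℕ) → ℕ) : Set where
  field
    mono  : ∀ {f g} → (∀ x → f x ≤ g x) → I f ≤ I g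
    add   : ∀ f g → I (λ x → f x + g x) ≡ I f + I g
    scale : ∀ f c → I (λ x → f x * c) ≡ I f * c

  ext : ∀ {f g} → (∀ x → f x ≡ g x) → I f ≡ I g
  ext f≡g = ≤-antisym (mono λ x → ≤-reflexive (f≡g x)) (mono λ x → ≤-reflexive (sym (f≡g x)))

  null : I (λ _ → 0) ≡ 0
  null = trans (scale (λ _ → 0) 0) (*-zeroʳ (I λ _ → 0))

open Positive

-- The product functional, for `l` independent draws.
iterate : {A : Set} → ((A → ℕ) → ℕ) → ∀ l → (Vec A l → ℕ) → ℕ
iterate I zero    f = f []
iterate I (suc l) f = I λ x → iterate I l λ xs → f (x ∷ xs)

iterate-positive : {A : Set} {I : (A → ℕ) → ℕ} → Positive I → ∀ l → Positive (iterate I l)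
iterate-positive {I = I} I⁺ = go
  where
  go : ∀ l → Positive (iterate I l)
  go zero = record { mono = λ f≤g → f≤g [] ; add = λ _ _ → refl ; scale = λ _ _ → refl }
  go (suc l) = record
    { mono  = λ f≤g → mono I⁺ λ x → mono (go l) λ xs → f≤g (x ∷ xs)
    ; add   = λ f g → trans (ext I⁺ λ x → add (go l) _ _) (add I⁺ _ _)
    ; scale = λ f c → trans (ext I⁺ λ x → scale (go l) _ c) (scale I⁺ _ c)
    }

prodVec : {A : Set} → (A → ℕ) → ∀ {l} → Vec A l → ℕ
prodVec f []       = 1
prodVec f (x ∷ xs) = prodVec f xs * f x

prodVec≡1 : {A : Set} (f : A → ℕ) → ∀ {l} (xs : Vec A l) → (∀ i → f (lookup xs i) ≡ 1) → prodVec f xs ≡ 1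
prodVec≡1 f []       f≡1 = refl
prodVec≡1 f (x ∷ xs) f≡1 = cong₂ _*_ (prodVec≡1 f xs λ i → f≡1 (suc i)) (f≡1 zero)

-- Independence: `scale` pulls the factor of each draw out of the functional over the later draws.
iterate-prodVec : {A : Set} {I : (A → ℕ) → ℕ} → Positive I → ∀ f l → iterate I l (prodVec f) ≡ I f ^ l
iterate-prodVec I⁺ f zero = refl
iterate-prodVec {I = I} I⁺ f (suc l) = begin
  I (λ x → iterate I l λ xs → prodVec f xs * f x) ≡⟨ ext I⁺ (λ x → scale (iterate-positive I⁺ l) _ (f x)) ⟩
  I (λ x → iterate I l (prodVec f) * f x)         ≡⟨ ext I⁺ (λ x → trans (cong (_* f x) (iterate-prodVec I⁺ f l)) (*-comm _ (f x))) ⟩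
  I (λ x → f x * I f ^ l)                         ≡⟨ scale I⁺ f _ ⟩
  I f * I f ^ l                                   ∎
  where open ≡-Reasoning

iterate-const : {A : Set} {I : (A → ℕ) → ℕ} → Positive I → ∀ l → iterate I l (λ _ → 1) ≡ I (λ _ → 1) ^ l
iterate-const I⁺ l =
  trans (ext (iterate-positive I⁺ l) λ xs → sym (prodVec≡1 _ xs λ _ → refl)) (iterate-prodVec I⁺ (λ _ → 1) l)

-- Sums over the subsets of a given size

sumSubsets : ∀ l → ℕ → (Subset l → ℕ) → ℕ
sumSubsets zero    zero    f = f []
sumSubsets zero    (suc m) f = 0
sumSubsets (suc l) zero    f = sumSubsets l zero λ p → f (false ∷ p)
sumSubsets (suc l) (suc m) f = sumSubsets l m (λ p → f (true ∷ p)) + sumSubsets l (suc m) (λ p → f (false ∷ p))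

f≤sumSubsets : ∀ {l} m (f : Subset l → ℕ) p → ∣ p ∣ ≡ m → f p ≤ sumSubsets l m f
f≤sumSubsets zero    f []          eq = ≤-refl
f≤sumSubsets zero    f (false ∷ p) eq = f≤sumSubsets zero (λ q → f (false ∷ q)) p eq
f≤sumSubsets (suc m) f (true ∷ p)  eq = ≤-trans (f≤sumSubsets m (λ q → f (true ∷ q)) p (suc-injective eq)) (m≤m+n _ _)
f≤sumSubsets (suc m) f (false ∷ p) eq = ≤-trans (f≤sumSubsets (suc m) (λ q → f (false ∷ q)) p eq) (m≤n+m _ _)

-- Linearity of expectation, as the union bound needs it.
sumSubsets-commute : {A : Set} {I : (A → ℕ) → ℕ} → Positive I → ∀ l m (f : A → Subset l → ℕ) →
  I (λ x → sumSubsets l m (f x)) ≡ sumSubsets l m (λ p → I λ x → f x p)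
sumSubsets-commute I⁺ zero    zero    f = refl
sumSubsets-commute I⁺ zero    (suc m) f = null I⁺
sumSubsets-commute I⁺ (suc l) zero    f = sumSubsets-commute I⁺ l zero _
sumSubsets-commute I⁺ (suc l) (suc m) f =
  trans (add I⁺ _ _) (cong₂ _+_ (sumSubsets-commute I⁺ l m _) (sumSubsets-commute I⁺ l (suc m) _))

-- This is C(l,m) m! ≤ l^m with weights: the recursion is Pascal's rule and `bernoulli` recombines
-- its two parts. The factor `z` clears the denominator in a bound c/z on each summand.
sumSubsets-bound : ∀ l m (f : Subset l → ℕ) z c → (∀ p → ∣ p ∣ ≡ m → f p * z ≤ c) →
  sumSubsets l m f * z * m ! ≤ l ^ m * c
sumSubsets-bound zero    zero    f z c f≤c = ≤-trans (*-monoˡ-≤ 1 (f≤c [] refl)) (≤-reflexive (*-comm c 1))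
sumSubsets-bound zero    (suc m) f z c f≤c = z≤n
sumSubsets-bound (suc l) zero    f z c f≤c = sumSubsets-bound l zero _ z c λ p → f≤c (false ∷ p)
sumSubsets-bound (suc l) (suc m) f z c f≤c = begin
  (s₁ + s₂) * z * suc m !                ≡⟨ split s₁ s₂ z (suc m) (m !) ⟩
  suc m * (s₁ * z * m !) + s₂ * z * suc m !
    ≤⟨ +-mono-≤ (*-monoʳ-≤ (suc m) (sumSubsets-bound l m _ z c λ p eq → f≤c (true ∷ p) (cong suc eq)))
                (sumSubsets-bound l (suc m) _ z c λ p → f≤c (false ∷ p)) ⟩
  suc m * (l ^ m * c) + l ^ suc m * c    ≡⟨ join (suc m) (l ^ m) c (l ^ suc m) ⟩
  (l ^ suc m + suc m * l ^ m) * c        ≤⟨ *-monoˡ-≤ c (bernoulli l m) ⟩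
  suc l ^ suc m * c                      ∎
  where
  open ≤-Reasoning
  s₁ = sumSubsets l m λ p → f (true ∷ p)
  s₂ = sumSubsets l (suc m) λ p → f (false ∷ p)
  split : ∀ s t z m o → (s + t) * z * (m * o) ≡ m * (s * z * o) + t * z * (m * o)
  split = solve-∀
  join : ∀ m x c y → m * (x * c) + y * c ≡ (y + m * x) * c
  join = solve-∀

-- Weighted counting of sequences

-- The expectation over one random coordinate, multiplied by a + b.
digitSum : ℕ → ℕ → ∀ {n} → (Fin (2 + n) → ℕ) → ℕ
digitSum a b f = b * f zero + a * f (suc zero)

digitSum-positive : ∀ a b {n} → Positive (digitSum a b {n})
digitSum-positive a b = record
  { mono  = λ f≤g → +-mono-≤ (*-monoʳ-≤ b (f≤g zero)) (*-monoʳ-≤ a (f≤g (suc zero)))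
  ; add   = λ f g → add-identity a b (f zero) (g zero) (f (suc zero)) (g (suc zero))
  ; scale = λ f c → scale-identity a b (f zero) (f (suc zero)) c
  }
  where
  add-identity : ∀ a b x x′ y y′ → b * (x + x′) + a * (y + y′) ≡ (b * x + a * y) + (b * x′ + a * y′)
  add-identity = solve-∀
  scale-identity : ∀ a b x y c → b * (x * c) + a * (y * c) ≡ (b * x + a * y) * c
  scale-identity = solve-∀

digitSum-1 : ∀ a b {n} → digitSum a b {n} (λ _ → 1) ≡ a + b
digitSum-1 a b = identity a b
  where
  identity : ∀ a b → b * 1 + a * 1 ≡ a + b
  identity = solve-∀

-- (a + b) ^ m times the expectation of f (c + number of ones among m draws).
walk : ℕ → ℕ → (ℕ → ℕ) → ℕ → ℕ → ℕ
walk a b f zero    c = f c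
walk a b f (suc m) c = b * walk a b f m c + a * walk a b f m (suc c)

-- An unselected position contributes only the factor `a + b`, while a selected one is a step of the
-- walk. The power of `a + b` on the left avoids a division.
columnSum-walk : ∀ a b {n} f {l} (p : Subset l) c →
  iterate (digitSum a b {n}) l (λ x → f (c + sumSel p (map toℕ x))) * (a + b) ^ ∣ p ∣
    ≡ (a + b) ^ l * walk a b f ∣ p ∣ c
columnSum-walk a b f [] c = trans (cong (λ x → f x * 1) (+-identityʳ c)) (*-comm (f c) 1)
columnSum-walk a b {n} f {suc l} (false ∷ p) c = begin
  (b * y + a * y) * (a + b) ^ q             ≡⟨ factor a b y ((a + b) ^ q) ⟩
  (a + b) * (y * (a + b) ^ q)               ≡⟨ cong ((a + b) *_) (columnSum-walk a b f p c) ⟩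
  (a + b) * ((a + b) ^ l * walk a b f q c)  ≡⟨ *-assoc (a + b) _ _ ⟨
  (a + b) ^ suc l * walk a b f q c          ∎
  where
  open ≡-Reasoning
  q = ∣ p ∣
  y = iterate (digitSum a b {n}) l (λ x → f (c + sumSel p (map toℕ x)))
  factor : ∀ a b y t → (b * y + a * y) * t ≡ (a + b) * (y * t)
  factor = solve-∀
columnSum-walk a b {n} f {suc l} (true ∷ p) c = begin
  (b * y + a * iterate (digitSum a b {n}) l (λ x → f (c + suc (sumSel p (map toℕ x))))) * (s * t)
    -- A one drawn at a selected position moves from the remaining sum into the counter.
    ≡⟨ cong (λ w → (b * y + a * w) * (s * t)) (ext (iterate-positive (digitSum-positive a b) l) λ x → cong f (+-suc c _)) ⟩
  (b * y + a * z) * (s * t)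
    ≡⟨ factor a b y z s t ⟩
  s * (b * (y * t) + a * (z * t))
    ≡⟨ cong₂ (λ v w → s * (b * v + a * w)) (columnSum-walk a b f p c) (columnSum-walk a b f p (suc c)) ⟩
  s * (b * (s ^ l * walk a b f q c) + a * (s ^ l * walk a b f q (suc c)))
    ≡⟨ unfactor a b s (s ^ l) _ _ ⟩
  s * s ^ l * (b * walk a b f q c + a * walk a b f q (suc c)) ∎
  where
  open ≡-Reasoning
  s = a + b
  q = ∣ p ∣
  t = s ^ q
  y = iterate (digitSum a b {n}) l (λ x → f (c + sumSel p (map toℕ x)))
  z = iterate (digitSum a b {n}) l (λ x → f (suc c + sumSel p (map toℕ x)))
  factor : ∀ a b y z s t → (b * y + a * z) * (s * t) ≡ s * (b * (y * t) + a * (z * t))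
  factor = solve-∀
  unfactor : ∀ a b s r v w → s * (b * (r * v) + a * (r * w)) ≡ s * r * (b * v + a * w)
  unfactor = solve-∀

isMultiple : ℕ → ℕ → ℕ
isMultiple n c = if does (n ∣? c) then 1 else 0

isMultiple≡1 : ∀ {n c} → n ∣ c → isMultiple n c ≡ 1
isMultiple≡1 {n} {c} n∣c with n ∣? c
... | yes _  = refl
... | no n∤c = contradiction n∣c n∤c

-- A transposition: the random choice is made coordinate by coordinate, whereas `Seq` lists group
-- elements.
columns→seq : ∀ {n r l} → Vec (Vec (Fin n) l) r → Seq n r l
columns→seq xs = tabulate λ i → tabulate λ j → lookup (lookup xs j) i

column-of-columns→seq : ∀ {n r l} (xs : Vec (Vec (Fin n) l) r) j →
  map (λ g → toℕ (lookup g j)) (columns→seq xs) ≡ map toℕ (lookup xs j)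
column-of-columns→seq xs j = begin
  map (λ g → toℕ (lookup g j)) (columns→seq xs)         ≡⟨ tabulate-∘ _ _ ⟨
  tabulate (λ i → toℕ (lookup (tabulate λ j′ → lookup (lookup xs j′) i) j))
    ≡⟨ tabulate-cong (λ i → cong toℕ (lookup∘tabulate (λ j′ → lookup (lookup xs j′) i) j)) ⟩
  tabulate (λ i → toℕ (lookup (lookup xs j) i))         ≡⟨ tabulate-∘ toℕ _ ⟩
  map toℕ (tabulate (lookup (lookup xs j)))             ≡⟨ cong (map toℕ) (tabulate∘lookup (lookup xs j)) ⟩
  map toℕ (lookup xs j)                                 ∎
  where open ≡-Reasoning

-- The union bound. Every sampled sequence has some zero-sum selection, so the total weight is at
-- most the weight summed over selections; independence of the coordinates turns each summand into
-- an `r`-th power. The modulus is at least 2, so that the digits 0 and 1 both exist.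
ZSProp⇒counting : ∀ a b {n} r m l → .{{_ : NonZero (a + b)}} → ZSProp (2 + n) r m l →
  ((a + b) ^ m) ^ r * m ! ≤ l ^ m * walk a b (isMultiple (2 + n)) m 0 ^ r
ZSProp⇒counting a b {n} r m l zs = *-cancelˡ-≤ (t ^ r) {{m^n≢0 t r {{m^n≢0 (a + b) l}}}} (begin
  t ^ r * (z * m !)
    ≡⟨ *-assoc (t ^ r) z (m !) ⟨
  t ^ r * z * m !
    ≡⟨ cong (λ x → x * z * m !) total ⟨
  iterate column r (λ _ → 1) * z * m !
    ≤⟨ *-monoˡ-≤ (m !) (*-monoˡ-≤ z (mono (iterate-positive column⁺ r) covered)) ⟩
  iterate column r (λ xs → sumSubsets l m λ p → prodVec (χ p) xs) * z * m !
    ≡⟨ cong (λ x → x * z * m !) (sumSubsets-commute (iterate-positive column⁺ r) l m _) ⟩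
  sumSubsets l m (λ p → iterate column r (prodVec (χ p))) * z * m !
    ≤⟨ sumSubsets-bound l m _ z (t ^ r * w ^ r) (λ p eq → ≤-reflexive (selected p eq)) ⟩
  l ^ m * (t ^ r * w ^ r)
    ≡⟨ x∙yz≈y∙xz (l ^ m) (t ^ r) (w ^ r) ⟩
  t ^ r * (l ^ m * w ^ r) ∎)
  where
  open ≤-Reasoning
  t = (a + b) ^ l
  z = ((a + b) ^ m) ^ r
  w = walk a b (isMultiple (2 + n)) m 0

  column : (Vec (Fin (2 + n)) l → ℕ) → ℕ
  column = iterate (digitSum a b) l

  column⁺ : Positive column
  column⁺ = iterate-positive (digitSum-positive a b) l

  χ : Subset l → Vec (Fin (2 + n)) l → ℕ
  χ p x = isMultiple (2 + n) (sumSel p (map toℕ x))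

  total : iterate column r (λ _ → 1) ≡ t ^ r
  total = trans (iterate-const column⁺ r)
    (cong (_^ r) (trans (iterate-const (digitSum-positive a b) l) (cong (_^ l) (digitSum-1 a b {n}))))

  covered : ∀ xs → 1 ≤ sumSubsets l m λ p → prodVec (χ p) xs
  covered xs with zs (columns→seq xs)
  ... | p , ∣p∣≡m , zero-sum = ≤-trans
    (≤-reflexive (sym (prodVec≡1 (χ p) xs λ j →
      isMultiple≡1 (subst (λ v → 2 + n ∣ sumSel p v) (column-of-columns→seq xs j) (zero-sum j)))))
    (f≤sumSubsets m (λ q → prodVec (χ q) xs) p ∣p∣≡m)

  selected : ∀ p → ∣ p ∣ ≡ m → iterate column r (prodVec (χ p)) * z ≡ t ^ r * w ^ r
  selected p refl = begin-equality
    iterate column r (prodVec (χ p)) * z  ≡⟨ cong (_* z) (iterate-prodVec column⁺ (χ p) r) ⟩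
    column (χ p) ^ r * z                  ≡⟨ ^-distribʳ-* (column (χ p)) _ r ⟨
    (column (χ p) * (a + b) ^ m) ^ r      ≡⟨ cong (_^ r) (columnSum-walk a b (isMultiple (2 + n)) p 0) ⟩
    (t * w) ^ r                           ≡⟨ ^-distribʳ-* t w r ⟩
    t ^ r * w ^ r                         ∎

-- The choice of weights

δ₀ : ℕ → ℕ
δ₀ zero    = 1
δ₀ (suc _) = 0

-- For u > 0 this reads `isMultiple n c` ≤ `δ₀ c` + (v/u)^(c-n): a nonzero multiple of n is at least
-- n, and v/u ≥ 1. The indicator is thus replaced by an exponential, as in Chernoff's method.
isMultiple-bound : ∀ {u v} n c → u ≤ v →
  isMultiple n c * (v ^ n * u ^ c) ≤ δ₀ c * v ^ n + u ^ n * v ^ c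
isMultiple-bound {u} {v} n c u≤v with n ∣? c
... | no _ = z≤n
isMultiple-bound {u} {v} n zero u≤v | yes _ =
  ≤-trans (≤-reflexive (cong (1 *_) (*-identityʳ (v ^ n)))) (m≤m+n _ _)
isMultiple-bound {u} {v} n c@(suc _) u≤v | yes n∣c = begin
  1 * (v ^ n * u ^ c)              ≡⟨ *-identityˡ _ ⟩
  v ^ n * u ^ c                    ≡⟨ cong (λ e → v ^ n * u ^ e) (m+[n∸m]≡n n≤c) ⟨
  v ^ n * u ^ (n + d)              ≡⟨ cong (v ^ n *_) (^-distribˡ-+-* u n d) ⟩
  v ^ n * (u ^ n * u ^ d)          ≤⟨ *-monoʳ-≤ (v ^ n) (*-monoʳ-≤ (u ^ n) (^-monoˡ-≤ d u≤v)) ⟩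
  v ^ n * (u ^ n * v ^ d)          ≡⟨ x∙yz≈y∙xz (v ^ n) (u ^ n) (v ^ d) ⟩
  u ^ n * (v ^ n * v ^ d)          ≡⟨ cong (u ^ n *_) (^-distribˡ-+-* v n d) ⟨
  u ^ n * v ^ (n + d)              ≡⟨ cong (λ e → u ^ n * v ^ e) (m+[n∸m]≡n n≤c) ⟩
  u ^ n * v ^ c                    ∎
  where
  open ≤-Reasoning
  n≤c = ∣⇒≤ n∣c
  d = c ∸ n

-- With u = aj > 0, the exponential (b/u)^c is an eigenfunction of one step of the walk, with
-- eigenvalue b(j+1)/j. The `δ₀` part survives only when every draw is 0, which gives the factor b
-- per step.
walk-bound : ∀ a b f j n → (∀ c → f c * (b ^ n * (a * j) ^ c) ≤ δ₀ c * b ^ n + (a * j) ^ n * b ^ c) →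
  ∀ m c → walk a b f m c * (b ^ n * (a * j) ^ c) * j ^ m
    ≤ δ₀ c * b ^ n * (b * j) ^ m + (a * j) ^ n * b ^ c * (b * suc j) ^ m
walk-bound a b f j n f-bound zero c =
  ≤-trans (*-monoˡ-≤ 1 (f-bound c)) (≤-reflexive (*-distribʳ-+ 1 (δ₀ c * b ^ n) _))
walk-bound a b f j n f-bound (suc m) c = begin
  (b * walk a b f m c + a * walk a b f m (suc c)) * (b ^ n * u ^ c) * (j * j ^ m)
    ≡⟨ split a b j (walk a b f m c) (walk a b f m (suc c)) (b ^ n) (u ^ c) (j ^ m) ⟩
  b * j * (walk a b f m c * (b ^ n * u ^ c) * j ^ m) + walk a b f m (suc c) * (b ^ n * u ^ suc c) * j ^ m
    -- At `suc c` the `δ₀` term vanishes by computation.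
    ≤⟨ +-mono-≤ (*-monoʳ-≤ (b * j) (walk-bound a b f j n f-bound m c)) (walk-bound a b f j n f-bound m (suc c)) ⟩
  b * j * (δ₀ c * b ^ n * (b * j) ^ m + u ^ n * b ^ c * (b * suc j) ^ m) + u ^ n * b ^ suc c * (b * suc j) ^ m
    ≡⟨ join b j (δ₀ c * b ^ n) ((b * j) ^ m) (u ^ n) (b ^ c) ((b * suc j) ^ m) ⟩
  δ₀ c * b ^ n * (b * j) ^ suc m + u ^ n * b ^ c * (b * suc j) ^ suc m ∎
  where
  open ≤-Reasoning
  u = a * j
  split : ∀ a b j x y p q r → (b * x + a * y) * (p * q) * (j * r) ≡ b * j * (x * (p * q) * r) + y * (p * (a * j * q)) * r
  split = solve-∀
  join : ∀ b j d x y z w → b * j * (d * x + y * z * w) + y * (b * z) * w ≡ d * (b * j * x) + y * z * (b * suc j * w)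
  join = solve-∀

-- With a = j ^ j and b = k ^ k, where k = j + 1, the two terms of walk-bound coincide at m = k n.
walk-isMultiple-bound : ∀ j n .{{_ : NonZero j}} → let k = suc j in
  walk (j ^ j) (k ^ k) (isMultiple n) (k * n) 0 ≤ 2 * (k ^ k) ^ (k * n)
walk-isMultiple-bound j n = *-cancelʳ-≤ w (2 * b ^ m) (b ^ n * j ^ m) {{m*n≢0 (b ^ n) (j ^ m) {{m^n≢0 b n {{m^n≢0 k k}}}} {{m^n≢0 j m}}}} (begin
  w * (b ^ n * j ^ m)
    ≡⟨ cong (λ x → w * (x * j ^ m)) (*-identityʳ (b ^ n)) ⟨
  w * (b ^ n * 1 * j ^ m)
    ≡⟨ *-assoc w _ (j ^ m) ⟨
  w * (b ^ n * 1) * j ^ m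
    ≤⟨ walk-bound a b (isMultiple n) j n (λ c → isMultiple-bound n c u≤b) m 0 ⟩
  1 * b ^ n * (b * j) ^ m + (a * j) ^ n * 1 * (b * k) ^ m
    ≡⟨ cong₂ (λ x y → 1 * b ^ n * x + (a * j) ^ n * 1 * y) (^-distribʳ-* b j m) (^-distribʳ-* b k m) ⟩
  1 * b ^ n * (b ^ m * j ^ m) + (a * j) ^ n * 1 * (b ^ m * k ^ m)
    -- Both `(a * j) ^ n = j ^ m` and `k ^ m = b ^ n` hold because m = kn.
    ≡⟨ cong₂ (λ x y → 1 * b ^ n * (b ^ m * j ^ m) + x * 1 * (b ^ m * y)) u^n≡j^m (sym (^-*-assoc k k n)) ⟩
  1 * b ^ n * (b ^ m * j ^ m) + j ^ m * 1 * (b ^ m * b ^ n)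
    ≡⟨ collect (b ^ n) (b ^ m) (j ^ m) ⟩
  2 * b ^ m * (b ^ n * j ^ m) ∎)
  where
  open ≤-Reasoning
  k = suc j
  a = j ^ j
  b = k ^ k
  m = k * n
  w = walk a b (isMultiple n) m 0
  u≤b : a * j ≤ b
  u≤b = ≤-trans (≤-reflexive (*-comm a j)) (^-monoˡ-≤ k (n≤1+n j))
  u^n≡j^m : (a * j) ^ n ≡ j ^ m
  u^n≡j^m = trans (cong (_^ n) (*-comm a j)) (^-*-assoc j k n)
  collect : ∀ x y z → 1 * x * (y * z) + z * 1 * (y * x) ≡ 2 * y * (x * z)
  collect = solve-∀

-- The lower bound in natural numbers

[x*y]^r^m≡x^m^r*y^m^r : ∀ x y r m → ((x * y) ^ r) ^ m ≡ (x ^ m) ^ r * (y ^ m) ^ r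
[x*y]^r^m≡x^m^r*y^m^r x y r m = begin
  ((x * y) ^ r) ^ m      ≡⟨ ^-*-assoc (x * y) r m ⟩
  (x * y) ^ (r * m)      ≡⟨ cong ((x * y) ^_) (*-comm r m) ⟩
  (x * y) ^ (m * r)      ≡⟨ ^-*-assoc (x * y) m r ⟨
  ((x * y) ^ m) ^ r      ≡⟨ cong (_^ r) (^-distribʳ-* x y m) ⟩
  (x ^ m * y ^ m) ^ r    ≡⟨ ^-distribʳ-* (x ^ m) (y ^ m) r ⟩
  (x ^ m) ^ r * (y ^ m) ^ r ∎
  where open ≡-Reasoning

-- The theorem for C = 1+t with denominators cleared. Since the counting inequality controls
-- `s ^ m`, both sides are compared through their `m`-th powers.
ZSProp⇒bound : ∀ j o r s .{{_ : NonZero j}} .{{_ : NonZero r}} → let k = suc j; n = suc o in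
  ZSProp n r (k * n) s → k * n * ((j ^ j + k ^ k) * o) ^ r < s * (4 * (k ^ k * n) ^ r)
-- For n = 1 the left side is 0, so only s > 0 is needed: the empty sequence has no selection of
-- size k.
ZSProp⇒bound j zero (suc r) zero zs with zs []
... | [] , () , _
ZSProp⇒bound j zero (suc r) s@(suc _) zs = begin-strict
  k * 1 * ((a + b) * 0) ^ suc r     ≡⟨ cong (λ x → k * 1 * (x * ((a + b) * 0) ^ r)) (*-zeroʳ (a + b)) ⟩
  k * 1 * 0                         ≡⟨ *-zeroʳ (k * 1) ⟩
  0                                 <⟨ *-mono-≤ {1} {s} {1} (s≤s z≤n) (*-mono-≤ {1} {4} (s≤s z≤n) (m^n>0 (b * 1) (suc r))) ⟩
  s * (4 * (b * 1) ^ suc r)         ∎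
  where
  open ≤-Reasoning
  k = suc j
  a = j ^ j
  b = k ^ k
  instance
    b≢0 : NonZero (b * 1)
    b≢0 = m*n≢0 b 1 {{m^n≢0 k k}}
-- Now n ≥ 2, so the counting inequality applies and `x` is positive, which keeps the multiplication
-- by `x ^ m` strict.
ZSProp⇒bound j o@(suc o′) r s zs = ^-cancelˡ-< m (begin-strict
  (m * x) ^ m                 ≡⟨ ^-distribʳ-* m x m ⟩
  m ^ m * x ^ m               <⟨ *-monoˡ-< (x ^ m) {{m^n≢0 x m {{m^n≢0 ((a + b) * o) r}}}} (m^m<4^m*m! m) ⟩
  4 ^ m * m ! * x ^ m         ≡⟨ *-assoc (4 ^ m) (m !) (x ^ m) ⟩
  4 ^ m * (m ! * x ^ m)       ≤⟨ *-monoʳ-≤ (4 ^ m) halved ⟩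
  4 ^ m * (s ^ m * y ^ m)     ≡⟨ x∙yz≈y∙xz (4 ^ m) (s ^ m) (y ^ m) ⟩
  s ^ m * (4 ^ m * y ^ m)     ≡⟨ cong (s ^ m *_) (^-distribʳ-* 4 y m) ⟨
  s ^ m * (4 * y) ^ m         ≡⟨ ^-distribʳ-* s (4 * y) m ⟨
  (s * (4 * y)) ^ m           ∎)
  where
  open ≤-Reasoning
  k = suc j
  n = suc o
  a = j ^ j
  b = k ^ k
  m = k * n
  x = ((a + b) * o) ^ r
  y = (b * n) ^ r
  w = walk a b (isMultiple n) m 0

  instance
    a+b≢0 : NonZero (a + b)
    a+b≢0 = >-nonZero (≤-trans (m^n>0 k k) (m≤n+m b a))
    ao≢0 : NonZero ((a + b) * o)
    ao≢0 = m*n≢0 (a + b) o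

  regroup : ∀ p f c q → p * (f * (c * q)) ≡ c * f * (p * q)
  regroup = solve-∀
  regroup′ : ∀ p l c d → l * (p * c) * d ≡ p * (l * (c * d))
  regroup′ = solve-∀

  halved : m ! * x ^ m ≤ s ^ m * y ^ m
  halved = *-cancelˡ-≤ (2 ^ r) {{m^n≢0 2 r}} (begin
    2 ^ r * (m ! * x ^ m)
      ≡⟨ cong (λ z → 2 ^ r * (m ! * z)) ([x*y]^r^m≡x^m^r*y^m^r (a + b) o r m) ⟩
    2 ^ r * (m ! * (((a + b) ^ m) ^ r * (o ^ m) ^ r))
      ≡⟨ regroup (2 ^ r) (m !) (((a + b) ^ m) ^ r) ((o ^ m) ^ r) ⟩
    ((a + b) ^ m) ^ r * m ! * (2 ^ r * (o ^ m) ^ r)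
      ≡⟨ cong (((a + b) ^ m) ^ r * m ! *_) (^-distribʳ-* 2 (o ^ m) r) ⟨
    ((a + b) ^ m) ^ r * m ! * (2 * o ^ m) ^ r
      -- The `2 ^ r` introduced for cancellation is absorbed here by (n-1)^m, and reappears from the
      -- bound on the walk.
      ≤⟨ *-mono-≤ (ZSProp⇒counting a b r m s zs)
                  (^-monoˡ-≤ r (2*m^n≤[1+m]^n o m (≤-trans (n≤1+n o) (m≤m+n n (j * n))))) ⟩
    s ^ m * w ^ r * (n ^ m) ^ r
      ≤⟨ *-monoˡ-≤ ((n ^ m) ^ r) (*-monoʳ-≤ (s ^ m) (^-monoˡ-≤ r (walk-isMultiple-bound j n))) ⟩
    s ^ m * (2 * b ^ m) ^ r * (n ^ m) ^ r
      ≡⟨ cong (λ z → s ^ m * z * (n ^ m) ^ r) (^-distribʳ-* 2 (b ^ m) r) ⟩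
    s ^ m * (2 ^ r * (b ^ m) ^ r) * (n ^ m) ^ r
      ≡⟨ regroup′ (2 ^ r) (s ^ m) ((b ^ m) ^ r) ((n ^ m) ^ r) ⟩
    2 ^ r * (s ^ m * ((b ^ m) ^ r * (n ^ m) ^ r))
      ≡⟨ cong (λ z → 2 ^ r * (s ^ m * z)) ([x*y]^r^m≡x^m^r*y^m^r b n r m) ⟨
    2 ^ r * (s ^ m * y ^ m) ∎)

-- Passage to ℚ

infix 4 _≐_/_

-- Unnormalised fractions allow numerators and denominators to be multiplied without reduction to
-- lowest terms.
_≐_/_ : ℚ → ℕ → (q : ℕ) → .{{_ : NonZero q}} → Set
x ≐ p / q = toℚᵘ x ℚᵘ.≃ (+ p) ℚᵘ./ q

/-≐ : ∀ p q .{{_ : NonZero q}} → (+ p / q) ≐ p / q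
/-≐ p (suc q) = ℚₚ.toℚᵘ-fromℚᵘ (ℚᵘ.mkℚᵘ (+ p) q)

*-≐ : ∀ {x y} p q p′ q′ .{{_ : NonZero q}} .{{_ : NonZero q′}} → x ≐ p / q → y ≐ p′ / q′ →
  _≐_/_ (x *ℚ y) (p * p′) (q * q′) {{m*n≢0 q q′}}
*-≐ {x} {y} p q@(suc _) p′ q′@(suc _) x≐ y≐ = ℚᵘₚ.≃-trans (ℚₚ.toℚᵘ-homo-* x y)
  (ℚᵘₚ.≃-trans (ℚᵘₚ.*-cong x≐ y≐) (ℚᵘₚ.≃-reflexive (cong (λ i → i ℚᵘ./ (q * q′)) (sym (ℤₚ.pos-* p p′)))))

powℚ-≐ : ∀ {x} p q .{{_ : NonZero q}} → x ≐ p / q → ∀ r → _≐_/_ (powℚ x r) (p ^ r) (q ^ r) {{m^n≢0 q r}}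
powℚ-≐ p q x≐ zero    = ℚᵘₚ.≃-refl
powℚ-≐ p q x≐ (suc r) = *-≐ p q (p ^ r) (q ^ r) {{_}} {{m^n≢0 q r}} x≐ (powℚ-≐ p q x≐ r)

1+/-≐ : ∀ p q .{{_ : NonZero q}} → (1ℚ +ℚ (+ p / q)) ≐ (p + q) / q
1+/-≐ p q@(suc q′) = ℚᵘₚ.≃-trans (ℚₚ.toℚᵘ-homo-+ 1ℚ (+ p / q))
  (ℚᵘₚ.≃-trans (ℚᵘₚ.+-congʳ ℚᵘ.1ℚᵘ (/-≐ p q)) (ℚᵘ.*≡* (identity (+ p) (+ q))))
  where
  identity : ∀ p q → (ℤ.1ℤ ℤ.* q ℤ.+ p ℤ.* ℤ.1ℤ) ℤ.* q ≡ (p ℤ.+ q) ℤ.* (ℤ.1ℤ ℤ.* q)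
  identity = ℤ-solve-∀

1-1/-≐ : ∀ o → (1ℚ -ℚ (+ 1 / suc o)) ≐ o / suc o
1-1/-≐ o = ℚᵘₚ.≃-trans (ℚₚ.toℚᵘ-homo-+ 1ℚ (-ℚ (+ 1 / suc o)))
  (ℚᵘₚ.≃-trans (ℚᵘₚ.+-congʳ ℚᵘ.1ℚᵘ (ℚᵘₚ.≃-trans (ℚₚ.toℚᵘ-homo‿- (+ 1 / suc o)) (ℚᵘₚ.-‿cong (/-≐ 1 (suc o)))))
    (ℚᵘ.*≡* (identity (+ o))))
  where
  identity : ∀ o → (ℤ.1ℤ ℤ.* (ℤ.1ℤ ℤ.+ o) ℤ.+ ℤ.-1ℤ ℤ.* ℤ.1ℤ) ℤ.* (ℤ.1ℤ ℤ.+ o) ≡ o ℤ.* (ℤ.1ℤ ℤ.* (ℤ.1ℤ ℤ.+ o))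
  identity = ℤ-solve-∀

-- For C = 1+t this factors the bracket of the theorem as (1+t)(1-1/n), a product of nonnegative
-- fractions.
x-xy≡x[1-y] : ∀ x y → x -ℚ x *ℚ y ≡ x *ℚ (1ℚ -ℚ y)
x-xy≡x[1-y] x y = sym (trans (ℚₚ.*-distribˡ-+ x 1ℚ _)
  (cong₂ _+ℚ_ (ℚₚ.*-identityʳ x) (sym (ℚₚ.neg-distribʳ-* x y))))

≐-< : ∀ {x y} p q p′ q′ .{{_ : NonZero q}} .{{_ : NonZero q′}} → x ≐ p / q → y ≐ p′ / q′ →
  p * q′ < p′ * q → x <ℚ y
≐-< p q@(suc _) p′ q′@(suc _) x≐ y≐ pq′<p′q = ℚₚ.toℚᵘ-cancel-<
  (ℚᵘₚ.<-respˡ-≃ (ℚᵘₚ.≃-sym x≐) (ℚᵘₚ.<-respʳ-≃ (ℚᵘₚ.≃-sym y≐)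
    (ℚᵘ.*<* (subst₂ ℤ._<_ (ℤₚ.pos-* p q′) (ℤₚ.pos-* p′ q) (ℤ.+<+ pq′<p′q)))))

theorem1 : (k : ℕ) → 2 < k →
    Σ ℚ λ C → (0ℚ <ℚ C) ×
    ((n r : ℕ) → .{{_ : NonZero n}} → 1 ≤ r → (s : ℕ) → IsSm n r (k * n) s →
    ((+ (k * n) / 4) *ℚ powℚ (1ℚ +ℚ kTerm k -ℚ (C *ℚ (+ 1 / n))) r) <ℚ (+ s / 1))
theorem1 (suc j) 2<k = C , 0<C , bound
  where
  k = suc j
  a = j ^ j
  b = k ^ k
  C = 1ℚ +ℚ kTerm k

  instance
    j≢0 : NonZero j
    j≢0 = >-nonZero (<-trans (s≤s z≤n) (s≤s⁻¹ 2<k))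
    b≢0 : NonZero b
    b≢0 = m^n≢0 k k

  C≐ : C ≐ (a + b) / b
  C≐ = 1+/-≐ a b

  0<C : 0ℚ <ℚ C
  0<C = ≐-< 0 1 (a + b) b ℚᵘₚ.≃-refl C≐
    (≤-trans (m^n>0 k k) (≤-trans (m≤n+m b a) (≤-reflexive (sym (*-identityʳ (a + b))))))

  bound : (n r : ℕ) → .{{_ : NonZero n}} → 1 ≤ r → (s : ℕ) → IsSm n r (k * n) s →
    ((+ (k * n) / 4) *ℚ powℚ (C -ℚ (C *ℚ (+ 1 / n))) r) <ℚ (+ s / 1)
  bound n@(suc o) r 1≤r s (zs , _) =
    ≐-< (k * n * p ^ r) (4 * q ^ r) s 1 (*-≐ (k * n) 4 (p ^ r) (q ^ r) (/-≐ (k * n) 4) (powℚ-≐ p q base≐ r)) (/-≐ s 1)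
      (≤-trans (s≤s (≤-reflexive (*-identityʳ _))) (ZSProp⇒bound j o r s {{j≢0}} {{>-nonZero 1≤r}} zs))
    where
    p = (a + b) * o
    q = b * n

    instance
      q≢0 : NonZero q
      q≢0 = m*n≢0 b n
      q^r≢0 : NonZero (q ^ r)
      q^r≢0 = m^n≢0 q r
      4q^r≢0 : NonZero (4 * q ^ r)
      4q^r≢0 = m*n≢0 4 (q ^ r)

    base≐ : (C -ℚ (C *ℚ (+ 1 / n))) ≐ p / q
    base≐ = subst (λ x → x ≐ p / q) (sym (x-xy≡x[1-y] C (+ 1 / n))) (*-≐ (a + b) b o n C≐ (1-1/-≐ o))
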